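{- Let $m,n,a,b\in\mathbb{Z}$ with $n\ne0$, $b\neq 0$, $\gcd(m,n)=\gcd(a,b)=1$, and consider the equation $$a^nx^nz^m=b^ny^n$$ in unknowns $x,y,z$. If this equation is partition regular over $\mathbb{N}$, then $\frac ab$ is an $\frac mn$-power in $\mathbb{Q}$. If $\frac ab$ is an $\frac mn$-power in $\mathbb{N}$, then the equation is partition regular over $\mathbb{N}$.
   Context: The equation is partition regular over $\mathbb{N}$ if for every finite coloring $c$ of $\mathbb{N}$ there are $x,y,z\in\mathbb{N}$ with $c(x)=c(y)=c(z)$ satisfying it (with $z^m$ interpreted as a rational number when $m<0$). For a prime $p$, $\nu_p:\mathbb{Q}^\times\to\mathbb{Z}$ is the $p$-adic valuation. A nonzero rational $r$ is an $\frac mn$-power in $\mathbb{Q}$ if for every prime $p$, $m$ divides $n\,\nu_p(r)$; $r$ is an $\frac mn$-power in $\mathbb{N}$ if $r=l^{m/n}$ for some $l\in\mathbb{N}$, i.e. $r>0$ and $r^n=l^m$. -}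

module Defs where

open import Data.Nat as ℕ using (ℕ; zero; suc; NonZero)
open import Data.Nat.Divisibility as ℕD using ()
open import Data.Nat.Primality using (Prime)
open import Data.Integer as ℤ using (ℤ; +_; -[1+_]; +0; +[1+_])
open import Data.Integer.Divisibility as ℤD using ()
open import Data.Integer.GCD as ℤG using ()
open import Data.Rational as ℚ using (ℚ; mkℚ; 0ℚ; 1ℚ; _*_; _/_; ↥_; ↧ₙ_; 1/_; _>_)
open import Data.Fin using (Fin)
open import Data.Product using (Σ; ∃; _×_; _,_)
open import Relation.Nullary using (¬_)
open import Relation.Binary.PropositionalEquality using (_≡_; _≢_)

ℤ→ℚ : ℤ → ℚ
ℤ→ℚ i = i / 1

ℕ→ℚ : ℕ → ℚ
ℕ→ℚ k = (+ k) / 1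

-- Integer powers of rationals.
-- The reciprocal is made total with the convention 1/0 = 0; this only
-- matters for 0 raised to a negative exponent.

inv : ℚ → ℚ
inv (mkℚ +0 d c)         = 0ℚ
inv p@(mkℚ +[1+ n ] d c) = 1/ p
inv p@(mkℚ -[1+ n ] d c) = 1/ p

_^ℕ_ : ℚ → ℕ → ℚ
q ^ℕ zero  = 1ℚ
q ^ℕ suc k = q * (q ^ℕ k)

_^ℤ_ : ℚ → ℤ → ℚ
q ^ℤ (+ k)      = q ^ℕ k
q ^ℤ -[1+ k ]   = inv (q ^ℕ suc k)

Eqn : (m n a b : ℤ) (x y z : ℕ) → Set
Eqn m n a b x y z =
  (ℤ→ℚ a ^ℤ n) * (ℕ→ℚ x ^ℤ n) * (ℕ→ℚ z ^ℤ m) ≡ (ℤ→ℚ b ^ℤ n) * (ℕ→ℚ y ^ℤ n)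

-- Partition regularity over ℕ = {1,2,3,...}: every finite colouring
-- c : ℕ → Fin k admits a monochromatic solution with x,y,z ≥ 1.
-- (Colourings are given on all of ℕ; only values on positive integers
-- matter.)
PartitionRegular : (m n a b : ℤ) → Set
PartitionRegular m n a b =
  (k : ℕ) (c : ℕ → Fin k) →
  Σ ℕ λ x → Σ ℕ λ y → Σ ℕ λ z →
    NonZero x × NonZero y × NonZero z ×
    c x ≡ c y × c y ≡ c z × Eqn m n a b x y z

IsValℕ : (p N v : ℕ) → Set
IsValℕ p N v = (p ℕ.^ v) ℕD.∣ N × ¬ ((p ℕ.^ suc v) ℕD.∣ N)

IsVal : (p : ℕ) (r : ℚ) (v : ℤ) → Set
IsVal p r v = Σ ℕ λ i → Σ ℕ λ j →
  IsValℕ p ℤ.∣ ↥ r ∣ i × IsValℕ p (↧ₙ r) j × v ≡ (+ i) ℤ.- (+ j)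

IsPowerℚ : (m n : ℤ) (r : ℚ) → Set
IsPowerℚ m n r = r ≢ 0ℚ ×
  ((p : ℕ) → Prime p → (v : ℤ) → IsVal p r v → m ℤD.∣ (n ℤ.* v))

IsPowerℕ : (m n : ℤ) (r : ℚ) → Set
IsPowerℕ m n r = r > 0ℚ × Σ ℕ λ l → r ^ℤ n ≡ ℕ→ℚ l ^ℤ m

ratio : ℤ → ℤ → ℚ
ratio a b = ℤ→ℚ a * inv (ℤ→ℚ b)

{-# OPTIONS --safe #-}
module Submission where

-- Necessity: taking valuations, n νₚ(a/b) = n (νₚ(y) − νₚ(x)) − m νₚ(z), and a solution which is
-- monochromatic for the colouring by νₚ modulo |m| makes the right-hand side divisible by m.
--
-- Sufficiency: if (a/b)^n = l^m, the equation becomes x^n (l z)^m = y^n.  It is solved by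
-- l z = q^|n| and x, y with ratio q^|m|.  Searching among powers of l, q = l^w, this asks for
-- exponents e, e + |m| w and |n| w of the same colour.  These exist for every colouring: by van der
-- Waerden some colour contains a long progression; either one of the multiples |n| w of a
-- suitable step has that colour too, or these multiples use one colour less.

open import Defs
open import Data.Nat.Base as ℕ using (ℕ; zero; suc; NonZero; z≤n; s≤s)
import Data.Nat.Properties as ℕₚ
import Data.Nat.Divisibility as ℕ∣
open import Data.Nat.DivMod using (_%_; _/_; _mod_; m≡m%n+[m/n]*n; m%n<n)
open import Data.Nat.Induction using (<-rec)
open import Data.Nat.Primality using (Prime; euclidsLemma; prime⇒nonZero; prime⇒nonTrivial)
import Data.Nat.Tactic.RingSolver as ℕ-Solver
open import Data.Integer using (ℤ; 0ℤ; 1ℤ)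
open import Data.Integer.Base as ℤ using (+_; -[1+_]; +0; +[1+_]; ∣_∣)
import Data.Integer.Properties as ℤₚ
open import Data.Integer.GCD using (gcd)
import Data.Integer.Divisibility as ℤ∣
import Data.Integer.Divisibility.Signed as ℤ∣ₛ
import Data.Integer.Tactic.RingSolver as ℤ-Solver
open import Data.Rational.Base using (ℚ; mkℚ; 0ℚ; 1ℚ; ↥_; ↧ₙ_; toℚᵘ)
import Data.Rational.Properties as ℚₚ
open import Data.Rational.Unnormalised.Base as ℚᵘ using (mkℚᵘ; *≡*)
import Data.Rational.Unnormalised.Properties as ℚᵘₚ
open import Data.Fin.Base using (Fin; zero; suc; toℕ; fromℕ<; funToFin; finToFun)
import Data.Fin.Properties as Finₚ
open import Algebra.Bundles using (CommutativeMonoid)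
open import Algebra.Properties.CommutativeSemigroup
  (CommutativeMonoid.commutativeSemigroup ℚₚ.*-1-commutativeMonoid) using (interchange)
open import Data.Product using (_×_; _,_; ∃; ∃₂; proj₁; proj₂)
open import Data.Sum using (_⊎_; inj₁; inj₂)
open import Data.Empty using (⊥-elim)
open import Function.Base using (_∘_)
open import Relation.Nullary using (¬_; yes; no; contradiction)
open import Relation.Binary using (tri<; tri≈; tri>)
open import Relation.Binary.PropositionalEquality

-- Monochromatic progressions

module Progressions where
  open import Data.Nat.Base using (_+_; _*_; _^_; _≤_; _<_)

  private variable
    k : ℕ

  Colouring : ℕ → Set
  Colouring k = ℕ → Fin k

  Monochromatic : Colouring k → (l a d : ℕ) → Set
  Monochromatic c l a d = ∀ i → i < l → c (a + i * d) ≡ c a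

  -- `N` bounds the start and the difference separately, not the last term. Below it is chosen
  -- before the colouring, which allows blocks of a fixed length.
  HasAP : Colouring k → (l N : ℕ) → Set
  HasAP c l N = ∃₂ λ a d → 1 ≤ d × a ≤ N × d ≤ N × Monochromatic c l a d

  -- The progressions are focused at f: it is the common next, (l+1)-st, term of all of them.
  record Fan (c : Colouring k) (l N f r : ℕ) : Set where
    field
      start step : Fin r → ℕ
      step≥1     : ∀ j → 1 ≤ step j
      step≤N     : ∀ j → step j ≤ N
      focus      : ∀ j → start j + l * step j ≡ f
      mono       : ∀ j → Monochromatic c l (start j) (step j)
      distinct   : ∀ {i j} → c (start i) ≡ c (start j) → i ≡ j

  HasFan : Colouring k → (l N r : ℕ) → Set
  HasFan c l N r = ∃ λ f → f ≤ N × Fan c l N f r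

  extend-AP : (c : Colouring k) (l a d : ℕ) → Monochromatic c l a d →
              c (a + l * d) ≡ c a → Monochromatic c (suc l) a d
  extend-AP c l a d mono eq i i≤l with ℕₚ.m≤n⇒m<n∨m≡n (ℕₚ.≤-pred i≤l)
  ... | inj₁ i<l  = mono i i<l
  ... | inj₂ refl = eq

  -- The whole pattern of `c` on the `B` integers from `i * B` on, packed into a single colour, so
  -- that a monochromatic progression becomes a progression of identical blocks.
  block : (B : ℕ) → Colouring k → Colouring (k ^ B)
  block B c i = funToFin λ (t : Fin B) → c (i * B + toℕ t)

  block-≡ : ∀ B (c : Colouring k) i j → block B c i ≡ block B c j →
            ∀ t → t < B → c (i * B + t) ≡ c (j * B + t)
  block-≡ B c i j eq t t<B = begin
    c (i * B + t)                        ≡⟨ entry i ⟩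
    finToFun (block B c i) (fromℕ< t<B)  ≡⟨ cong (λ b → finToFun b (fromℕ< t<B)) eq ⟩
    finToFun (block B c j) (fromℕ< t<B)  ≡⟨ entry j ⟨
    c (j * B + t)                        ∎
    where
    open ≡-Reasoning
    entry : ∀ i → c (i * B + t) ≡ finToFun (block B c i) (fromℕ< t<B)
    entry i = trans (cong (λ u → c (i * B + u)) (sym (Finₚ.toℕ-fromℕ< t<B)))
                    (sym (Finₚ.finToFun-funToFin _ (fromℕ< t<B)))

  -- The first hypothesis gives `l` equally spaced identical blocks; `IH` is applied to `c` shifted
  -- to the start of block `A`. If it yields a fan whose focus shares the colour of one of its
  -- progressions, that progression gains a term. Otherwise every progression is slanted across the
  -- blocks by a further `D * B` per term, and the copies of the focus form one more, of a new
  -- colour.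
  fan-step : ∀ l N₀ N₁ r (c : Colouring k) →
             HasAP (block (suc N₀) c) l N₁ →
             (∀ (c : Colouring k) → HasAP c (suc l) N₀ ⊎ HasFan c l N₀ r) →
             let N = suc l * (N₁ * suc N₀) + N₀ in
             HasAP c (suc l) N ⊎ HasFan c l N (suc r)
  fan-step {k} l N₀ N₁ r c (A , D , D≥1 , A≤ , D≤ , Mono) IH = result
    where
    B = suc N₀
    N = suc l * (N₁ * B) + N₀
    c₀ : Colouring k
    c₀ t = c (A * B + t)
    AB≤ : A * B ≤ N₁ * B
    AB≤ = ℕₚ.*-monoˡ-≤ B A≤
    DB≤ : D * B ≤ N₁ * B
    DB≤ = ℕₚ.*-monoˡ-≤ B D≤
    N₁B+N₀≤N : N₁ * B + N₀ ≤ N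
    N₁B+N₀≤N = ℕₚ.+-monoˡ-≤ N₀ (ℕₚ.m≤m+n (N₁ * B) (l * (N₁ * B)))
    DB≥1 : 1 ≤ D * B
    DB≥1 = ℕₚ.*-mono-≤ D≥1 (s≤s z≤n)

    lift-AP : ∀ {a d} → 1 ≤ d → a ≤ N₀ → d ≤ N₀ → Monochromatic c₀ (suc l) a d → HasAP c (suc l) N
    lift-AP {a} {d} d≥1 a≤ d≤ m =
      A * B + a , d , d≥1 , ℕₚ.≤-trans (ℕₚ.+-mono-≤ AB≤ a≤) N₁B+N₀≤N ,
      ℕₚ.≤-trans d≤ (ℕₚ.m≤n+m N₀ _) ,
      λ i i<l → trans (cong c (ℕₚ.+-assoc (A * B) a (i * d))) (m i i<l)

    -- The shift leads to the same place in block `A + i * D`, which has the same pattern; `t ≤ N₀`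
    -- keeps the point inside its block.
    move : ∀ i → i < l → ∀ t → t ≤ N₀ → c (A * B + t + i * (D * B)) ≡ c (A * B + t)
    move i i<l t t≤ = trans (cong c (arith A B t i D))
      (block-≡ B c (A + i * D) A (Mono i i<l) t (s≤s t≤))
      where
      arith : ∀ A B t i D → A * B + t + i * (D * B) ≡ (A + i * D) * B + t
      arith = ℕ-Solver.solve-∀

    result : HasAP c (suc l) N ⊎ HasFan c l N (suc r)
    result with IH c₀
    ... | inj₁ (a , d , d≥1 , a≤ , d≤ , m) = inj₁ (lift-AP d≥1 a≤ d≤ m)
    ... | inj₂ (f , f≤ , fan) with Finₚ.any? (λ j → c₀ f Finₚ.≟ c₀ (Fan.start fan j))
    ... | yes (j , eq) = inj₁ (lift-AP (step≥1 j) a≤ (step≤N j)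
            (extend-AP c₀ l (start j) (step j) (mono j) (trans (cong c₀ (focus j)) eq)))
      where
      open Fan fan
      a≤ = ℕₚ.≤-trans (ℕₚ.m≤m+n (start j) (l * step j)) (ℕₚ.≤-trans (ℕₚ.≤-reflexive (focus j)) f≤)
    ... | no fresh = inj₂ (F , F≤N , record
            { start = start′ ; step = step′ ; step≥1 = step′≥1 ; step≤N = step′≤N
            ; focus = focus′ ; mono = mono′ ; distinct = distinct′ })
      where
      open Fan fan
      -- The copy of `f` in block `A + l * D`, the next one after those known to be identical.
      F = A * B + f + l * (D * B)
      start′ step′ : Fin (suc r) → ℕ
      start′ zero    = A * B + f
      start′ (suc j) = A * B + start j
      step′ zero    = D * B
      step′ (suc j) = step j + D * B
      F≤N : F ≤ N
      F≤N = ℕₚ.≤-trans (ℕₚ.+-mono-≤ (ℕₚ.+-mono-≤ AB≤ f≤) (ℕₚ.*-monoʳ-≤ l DB≤))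
                       (ℕₚ.≤-reflexive (arith (N₁ * B) N₀ l))
        where
        arith : ∀ x y l → x + y + l * x ≡ suc l * x + y
        arith = ℕ-Solver.solve-∀
      step′≥1 : ∀ j → 1 ≤ step′ j
      step′≥1 zero    = DB≥1
      step′≥1 (suc j) = ℕₚ.≤-trans DB≥1 (ℕₚ.m≤n+m (D * B) (step j))
      step′≤N : ∀ j → step′ j ≤ N
      step′≤N zero    = ℕₚ.≤-trans DB≤ (ℕₚ.≤-trans (ℕₚ.m≤m+n _ N₀) N₁B+N₀≤N)
      step′≤N (suc j) = ℕₚ.≤-trans (ℕₚ.+-mono-≤ (step≤N j) DB≤)
                          (ℕₚ.≤-trans (ℕₚ.≤-reflexive (ℕₚ.+-comm N₀ (N₁ * B))) N₁B+N₀≤N)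
      focus′ : ∀ j → start′ j + l * step′ j ≡ F
      focus′ zero    = refl
      focus′ (suc j) = trans (arith (A * B) (start j) l (step j) (D * B))
                             (cong (λ f → A * B + f + l * (D * B)) (focus j))
        where
        arith : ∀ x a l d y → x + a + l * (d + y) ≡ x + (a + l * d) + l * y
        arith = ℕ-Solver.solve-∀
      mono′ : ∀ j → Monochromatic c l (start′ j) (step′ j)
      mono′ zero    i i<l = move i i<l f f≤
      mono′ (suc j) i i<l = begin
        c (A * B + start j + i * (step j + D * B))      ≡⟨ cong c (arith (A * B) (start j) i (step j) (D * B)) ⟩
        c (A * B + (start j + i * step j) + i * (D * B)) ≡⟨ move i i<l (start j + i * step j) term≤ ⟩
        c (A * B + (start j + i * step j))               ≡⟨ mono j i i<l ⟩
        c (A * B + start j)                              ∎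
        where
        open ≡-Reasoning
        arith : ∀ x a i d y → x + a + i * (d + y) ≡ x + (a + i * d) + i * y
        arith = ℕ-Solver.solve-∀
        term≤ : start j + i * step j ≤ N₀
        term≤ = ℕₚ.≤-trans (ℕₚ.+-monoʳ-≤ (start j) (ℕₚ.*-monoˡ-≤ (step j) (ℕₚ.<⇒≤ i<l)))
                  (ℕₚ.≤-trans (ℕₚ.≤-reflexive (focus j)) f≤)
      distinct′ : ∀ {i j} → c (start′ i) ≡ c (start′ j) → i ≡ j
      distinct′ {zero}  {zero}  eq = refl
      distinct′ {zero}  {suc j} eq = ⊥-elim (fresh (j , eq))
      distinct′ {suc i} {zero}  eq = ⊥-elim (fresh (i , sym eq))
      distinct′ {suc i} {suc j} eq = cong suc (distinct eq)

  -- Induction on `r`, starting from the empty fan. The blocks have to hold a fan of `r`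
  -- progressions, and their patterns use `k ^ suc N₀` colours; this is why length `l` is assumed
  -- for every number of colours.
  fan-or-AP : ∀ l → (∀ k → ∃ λ N → (c : Colouring k) → HasAP c l N) → ∀ k r →
              ∃ λ N → (c : Colouring k) → HasAP c (suc l) N ⊎ HasFan c l N r
  fan-or-AP l vdW k zero = 0 , λ c → inj₂ (0 , z≤n , record
    { start = λ () ; step = λ () ; step≥1 = λ () ; step≤N = λ ()
    ; focus = λ () ; mono = λ () ; distinct = λ { {()} } })
  fan-or-AP l vdW k (suc r) with fan-or-AP l vdW k r
  ... | N₀ , IH with vdW (k ^ suc N₀)
  ... | N₁ , ap = _ , λ c → fan-step l N₀ N₁ r c (ap (block (suc N₀) c)) IH

  no-injection : ∀ {r} → k < r → (g : Fin r → Fin k) → ¬ (∀ {i j} → g i ≡ g j → i ≡ j)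
  no-injection k<r g inj with Finₚ.pigeonhole k<r g
  ... | i , j , i<j , eq = Finₚ.<⇒≢ i<j (inj eq)

  -- Induction on the length. A fan of `suc k` progressions would show `suc k` different colours, so
  -- only the longer progression remains.
  van-der-Waerden : ∀ l k → ∃ λ N → (c : Colouring k) → HasAP c l N
  -- No terms are asked for; `N` is 1 to admit the difference 1.
  van-der-Waerden zero    k = 1 , λ c → 0 , 1 , s≤s z≤n , z≤n , s≤s z≤n , λ i ()
  van-der-Waerden (suc l) k with fan-or-AP l (van-der-Waerden l) k (suc k)
  ... | N , fan∨AP = N , λ c → conclude c (fan∨AP c)
    where
    conclude : ∀ c → HasAP c (suc l) N ⊎ HasFan c l N (suc k) → HasAP c (suc l) N
    conclude c (inj₁ ap)            = ap
    conclude c (inj₂ (_ , _ , fan)) =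
      ⊥-elim (no-injection ℕₚ.≤-refl (c ∘ Fan.start fan) (Fan.distinct fan))

  -- Brauer's theorem: a progression together with its difference

  Brauer : Colouring k → (m n : ℕ) → Set
  Brauer c m n = ∃₂ λ e w → 1 ≤ e × 1 ≤ w × c e ≡ c (e + m * w) × c e ≡ c (n * w)

  record Avoids (c : Colouring k) (L r : ℕ) : Set where
    field
      scale    : ℕ
      scale≥1  : 1 ≤ scale
      colour   : Fin r → Fin k
      distinct : ∀ {i j} → colour i ≡ colour j → i ≡ j
      avoids   : ∀ i → 1 ≤ i → i ≤ L → ∀ j → c (scale * i) ≢ colour j

  -- A long monochromatic progression of difference d inside the multiples of the scale forces,
  -- unless there is a solution, all small multiples of n * d in that scale to avoid its colour.
  avoid-more : ∀ m n → 1 ≤ n → (c : Colouring k) → ∀ r L → Brauer c m n ⊎ Avoids c L r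
  avoid-more m n n≥1 c zero L = inj₂ (record
    { scale = 1 ; scale≥1 = s≤s z≤n ; colour = λ () ; distinct = λ { {()} } ; avoids = λ _ _ _ () })
  -- Terms of index 0 to `m * L` are needed, as `e + m * w` will be the term of index `m * i` for
  -- some `i ≤ L`.
  avoid-more {k} m n n≥1 c (suc r) L with van-der-Waerden (suc (m * L)) k
  -- `suc N` makes room for the factor `suc a`, so that its colour is new; `n * N * L` makes room
  -- for the factors `n * d * i`, so that the old colours stay avoided.
  ... | N , vdW with avoid-more m n n≥1 c r (suc N + n * N * L)
  ... | inj₁ sol = inj₁ sol
  -- Shifted by one, since only positive multiples of the scale are known to avoid the old colours.
  ... | inj₂ av with vdW (λ i → c (Avoids.scale av * suc i))
  ... | a , d , d≥1 , a≤N , d≤N , mono = result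
    where
    open Avoids av
    s = scale
    red = c (s * suc a)
    nd≥1 : 1 ≤ n * d
    nd≥1 = ℕₚ.*-mono-≤ n≥1 d≥1
    w≥1 : ∀ {i} → 1 ≤ i → 1 ≤ s * (d * i)
    w≥1 i≥1 = ℕₚ.*-mono-≤ scale≥1 (ℕₚ.*-mono-≤ d≥1 i≥1)

    result : Brauer c m n ⊎ Avoids c L (suc r)
    result with ℕₚ.anyUpTo? (λ i → c (s * (n * d) * suc i) Finₚ.≟ red) L
    -- With `w = s * (d * suc i)`, the red multiple found is `n * w`, and `e + m * w` is the term of
    -- index `m * suc i` of the red progression.
    ... | yes (i , i<L , eq) = inj₁ (s * suc a , s * (d * suc i) ,
            ℕₚ.*-mono-≤ scale≥1 (s≤s z≤n) , w≥1 (s≤s z≤n) ,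
            sym (trans (cong c (arith₁ s a m d (suc i))) (mono (m * suc i) (s≤s (ℕₚ.*-monoʳ-≤ m i<L)))) ,
            sym (trans (cong c (arith₂ s n d (suc i))) eq))
      where
      arith₁ : ∀ s a m d i → s * suc a + m * (s * (d * i)) ≡ s * suc (a + m * i * d)
      arith₁ = ℕ-Solver.solve-∀
      arith₂ : ∀ s n d i → n * (s * (d * i)) ≡ s * (n * d) * i
      arith₂ = ℕ-Solver.solve-∀
    ... | no none = inj₂ (record
            { scale = s * (n * d) ; scale≥1 = ℕₚ.*-mono-≤ scale≥1 nd≥1
            ; colour = colour′ ; distinct = distinct′ ; avoids = avoids′ })
      where
      fresh : ∀ j → red ≢ colour j
      fresh j = avoids (suc a) (s≤s z≤n) (ℕₚ.≤-trans (s≤s a≤N) (ℕₚ.m≤m+n (suc N) _)) j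
      colour′ : Fin (suc r) → Fin k
      colour′ zero    = red
      colour′ (suc j) = colour j
      distinct′ : ∀ {i j} → colour′ i ≡ colour′ j → i ≡ j
      distinct′ {zero}  {zero}  eq = refl
      distinct′ {zero}  {suc j} eq = ⊥-elim (fresh j eq)
      distinct′ {suc i} {zero}  eq = ⊥-elim (fresh i (sym eq))
      distinct′ {suc i} {suc j} eq = cong suc (distinct eq)
      avoids′ : ∀ i → 1 ≤ i → i ≤ L → ∀ j → c (s * (n * d) * i) ≢ colour′ j
      avoids′ (suc i) i≥1 i≤L zero    eq = none (i , i≤L , eq)
      avoids′ i       i≥1 i≤L (suc j) eq =
        avoids (n * d * i) (ℕₚ.*-mono-≤ nd≥1 i≥1)
          (ℕₚ.≤-trans (ℕₚ.*-mono-≤ (ℕₚ.*-monoʳ-≤ n d≤N) i≤L) (ℕₚ.m≤n+m _ (suc N))) j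
          (trans (cong c (sym (ℕₚ.*-assoc s (n * d) i))) eq)

  -- There are no `suc k` different colours among `k`, whether or not any multiples avoid them,
  -- hence `L = 0`. For `m = n = 1` this is Schur's theorem.
  brauer : ∀ m n → 1 ≤ n → (c : Colouring k) → Brauer c m n
  brauer {k} m n n≥1 c with avoid-more m n n≥1 c (suc k) 0
  ... | inj₁ sol = sol
  ... | inj₂ av  = ⊥-elim (no-injection ℕₚ.≤-refl (Avoids.colour av) (Avoids.distinct av))

open Progressions using (Colouring; brauer)

-- Powers of rationals

open import Data.Rational.Base using (_*_)
open ≡-Reasoning

*-invʳ : ∀ q → q ≢ 0ℚ → q * inv q ≡ 1ℚ
*-invʳ q@(mkℚ +0 _ _)       q≢0 = contradiction (ℚₚ.↥p≡0⇒p≡0 q refl) q≢0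
*-invʳ q@(mkℚ +[1+ _ ] _ _) _   = ℚₚ.*-inverseʳ q
*-invʳ q@(mkℚ -[1+ _ ] _ _) _   = ℚₚ.*-inverseʳ q

*-cancel-inv : ∀ p q → q ≢ 0ℚ → p * q * inv q ≡ p
*-cancel-inv p q q≢0 = begin
  p * q * inv q    ≡⟨ ℚₚ.*-assoc p q (inv q) ⟩
  p * (q * inv q)  ≡⟨ cong (p *_) (*-invʳ q q≢0) ⟩
  p * 1ℚ           ≡⟨ ℚₚ.*-identityʳ p ⟩
  p                ∎

inv-cancel-* : ∀ p q → q ≢ 0ℚ → p * inv q * q ≡ p
inv-cancel-* p q q≢0 = begin
  p * inv q * q    ≡⟨ ℚₚ.*-assoc p (inv q) q ⟩
  p * (inv q * q)  ≡⟨ cong (p *_) (ℚₚ.*-comm (inv q) q) ⟩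
  p * (q * inv q)  ≡⟨ ℚₚ.*-assoc p q (inv q) ⟨
  p * q * inv q    ≡⟨ *-cancel-inv p q q≢0 ⟩
  p                ∎

*-≢0 : ∀ {p q} → p ≢ 0ℚ → q ≢ 0ℚ → p * q ≢ 0ℚ
*-≢0 {p} {q} p≢0 q≢0 pq≡0 = p≢0 (begin
  p              ≡⟨ *-cancel-inv p q q≢0 ⟨
  p * q * inv q  ≡⟨ cong (_* inv q) pq≡0 ⟩
  0ℚ * inv q     ≡⟨ ℚₚ.*-zeroˡ (inv q) ⟩
  0ℚ             ∎)

inv-≢0 : ∀ {q} → q ≢ 0ℚ → inv q ≢ 0ℚ
inv-≢0 {q} q≢0 eq = ℚₚ.1≢0 (trans (sym (*-invʳ q q≢0)) (trans (cong (q *_) eq) (ℚₚ.*-zeroʳ q)))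

^ℕ-≢0 : ∀ {q} k → q ≢ 0ℚ → q ^ℕ k ≢ 0ℚ
^ℕ-≢0 zero    q≢0 = ℚₚ.1≢0
^ℕ-≢0 (suc k) q≢0 = *-≢0 q≢0 (^ℕ-≢0 k q≢0)

^ℤ-≢0 : ∀ {q} i → q ≢ 0ℚ → q ^ℤ i ≢ 0ℚ
^ℤ-≢0 (+ k)    q≢0 = ^ℕ-≢0 k q≢0
^ℤ-≢0 -[1+ k ] q≢0 = inv-≢0 (^ℕ-≢0 (suc k) q≢0)

-- For negative exponents this rests on the convention that `inv 0ℚ` is `0ℚ`. It excludes `a = 0`,
-- and the root 0 when `m` is not 0.
0^ℤ : ∀ i → i ≢ +0 → 0ℚ ^ℤ i ≡ 0ℚ
0^ℤ +0       i≢0 = contradiction refl i≢0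
0^ℤ +[1+ k ] _   = ℚₚ.*-zeroˡ (0ℚ ^ℕ k)
0^ℤ -[1+ k ] _   = cong inv (ℚₚ.*-zeroˡ (0ℚ ^ℕ k))

inv-distrib-* : ∀ p q → p ≢ 0ℚ → q ≢ 0ℚ → inv (p * q) ≡ inv p * inv q
inv-distrib-* p q p≢0 q≢0 = begin
  inv (p * q)                                ≡⟨ ℚₚ.*-identityˡ _ ⟨
  1ℚ * inv (p * q)                           ≡⟨ cong (_* inv (p * q)) (cong₂ _*_ (*-invʳ p p≢0) (*-invʳ q q≢0)) ⟨
  (p * inv p) * (q * inv q) * inv (p * q)    ≡⟨ cong (_* inv (p * q)) (interchange p (inv p) q (inv q)) ⟩
  (p * q) * (inv p * inv q) * inv (p * q)    ≡⟨ cong (_* inv (p * q)) (ℚₚ.*-comm (p * q) _) ⟩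
  (inv p * inv q) * (p * q) * inv (p * q)    ≡⟨ *-cancel-inv _ (p * q) (*-≢0 p≢0 q≢0) ⟩
  inv p * inv q                              ∎

^ℕ-distrib-* : ∀ p q k → (p * q) ^ℕ k ≡ (p ^ℕ k) * (q ^ℕ k)
^ℕ-distrib-* p q zero    = refl
^ℕ-distrib-* p q (suc k) = begin
  p * q * ((p * q) ^ℕ k)          ≡⟨ cong (p * q *_) (^ℕ-distrib-* p q k) ⟩
  p * q * ((p ^ℕ k) * (q ^ℕ k))   ≡⟨ interchange p q (p ^ℕ k) (q ^ℕ k) ⟩
  p * (p ^ℕ k) * (q * (q ^ℕ k))   ∎

^ℤ-distrib-* : ∀ {p q} i → p ≢ 0ℚ → q ≢ 0ℚ → (p * q) ^ℤ i ≡ (p ^ℤ i) * (q ^ℤ i)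
^ℤ-distrib-* {p} {q} (+ k)    _   _   = ^ℕ-distrib-* p q k
^ℤ-distrib-* {p} {q} -[1+ k ] p≢0 q≢0 = trans (cong inv (^ℕ-distrib-* p q (suc k)))
  (inv-distrib-* _ _ (^ℕ-≢0 (suc k) p≢0) (^ℕ-≢0 (suc k) q≢0))

ℤ→ℚ-≢0 : ∀ i → i ≢ +0 → ℤ→ℚ i ≢ 0ℚ
-- `fromℚᵘ (mkℚᵘ i 0)` unfolds to `i / 1`, the denominator being stored minus one; comparing
-- unnormalised fractions avoids the gcd.
ℤ→ℚ-≢0 i i≢0 eq with ℚᵘₚ.≃-trans (ℚᵘₚ.≃-sym (ℚₚ.toℚᵘ-fromℚᵘ (mkℚᵘ i 0))) (ℚₚ.toℚᵘ-cong eq)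
... | *≡* i*1≡0 = i≢0 (trans (sym (ℤₚ.*-identityʳ i)) i*1≡0)

ℕ→ℚ-≢0 : ∀ x → .{{ℕ.NonZero x}} → ℕ→ℚ x ≢ 0ℚ
ℕ→ℚ-≢0 x@(suc _) = ℤ→ℚ-≢0 (+ x) λ ()

ℕ→ℚ-* : ∀ x y → ℕ→ℚ (x ℕ.* y) ≡ ℕ→ℚ x * ℕ→ℚ y
ℕ→ℚ-* x y = ℚₚ.toℚᵘ-injective
  (ℚᵘₚ.≃-trans (ℚₚ.toℚᵘ-fromℚᵘ (mkℚᵘ (+ (x ℕ.* y)) 0))
  (ℚᵘₚ.≃-trans (*≡* (cong (ℤ._* + 1) (ℤₚ.pos-* x y)))
  (ℚᵘₚ.≃-sym (ℚᵘₚ.≃-trans (ℚₚ.toℚᵘ-homo-* (ℕ→ℚ x) (ℕ→ℚ y))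
    (ℚᵘₚ.*-cong (ℚₚ.toℚᵘ-fromℚᵘ (mkℚᵘ (+ x) 0)) (ℚₚ.toℚᵘ-fromℚᵘ (mkℚᵘ (+ y) 0)))))))

ℕ→ℚ-^ : ∀ x k → ℕ→ℚ x ^ℕ k ≡ ℕ→ℚ (x ℕ.^ k)
ℕ→ℚ-^ x zero    = refl
ℕ→ℚ-^ x (suc k) = trans (cong (ℕ→ℚ x *_) (ℕ→ℚ-^ x k)) (sym (ℕ→ℚ-* x (x ℕ.^ k)))

-- p-adic valuations

≃ᵘ⇒cross-≡ : ∀ q u → toℚᵘ q ℚᵘ.≃ u → ∣ ↥ q ∣ ℕ.* ℚᵘ.↧ₙ u ≡ ∣ ℚᵘ.↥ u ∣ ℕ.* ↧ₙ q
≃ᵘ⇒cross-≡ q@record{} u (*≡* eq) =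
  trans (sym (ℤₚ.abs-* (↥ q) (ℚᵘ.↧ u))) (trans (cong ∣_∣ eq) (ℤₚ.abs-* (ℚᵘ.↥ u) (+ ↧ₙ q)))

module Valuation {p : ℕ} (prime : Prime p) where
  instance
    p≢0 : NonZero p
    p≢0 = prime⇒nonZero prime

  -- Well-founded recursion: each division by `p` leaves a smaller quotient and adds one to the
  -- exponent.
  IsValℕ-exists : ∀ N → .{{NonZero N}} → ∃ (IsValℕ p N)
  IsValℕ-exists N {{N≢0}} = <-rec (λ N → .(NonZero N) → ∃ (IsValℕ p N)) step N N≢0
    where
    step : ∀ N → (∀ {K} → K ℕ.< N → .(NonZero K) → ∃ (IsValℕ p K)) → .(NonZero N) → ∃ (IsValℕ p N)
    step N rec N≢0 with p ℕ∣.∣? N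
    ... | no  p∤N = 0 , ℕ∣.1∣ N , p∤N ∘ subst (ℕ∣._∣ N) (ℕₚ.*-identityʳ p)
    ... | yes (ℕ∣.divides-refl q) with rec q<N q≢0
      where
      q≢0 : NonZero q
      q≢0 = ℕₚ.m*n≢0⇒m≢0 q {{N≢0}}
      q<N : q ℕ.< q ℕ.* p
      q<N = ℕₚ.m<m*n q p {{q≢0}} (ℕ.nonTrivial⇒n>1 p {{prime⇒nonTrivial prime}})
    ... | v , pᵛ∣q , pᵛ⁺¹∤q = suc v ,
      subst (p ℕ.* p ℕ.^ v ℕ∣.∣_) (ℕₚ.*-comm p q) (ℕ∣.*-monoʳ-∣ p pᵛ∣q) ,
      λ d → pᵛ⁺¹∤q (ℕ∣.*-cancelˡ-∣ p (subst (p ℕ.* p ℕ.^ suc v ℕ∣.∣_) (ℕₚ.*-comm q p) d))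

  ^-monoʳ-∣ : ∀ {i j} → i ℕ.≤ j → p ℕ.^ i ℕ∣.∣ p ℕ.^ j
  ^-monoʳ-∣ {i} i≤j with ℕₚ.m≤n⇒∃[o]m+o≡n i≤j
  ... | o , refl = subst (p ℕ.^ i ℕ∣.∣_) (sym (ℕₚ.^-distribˡ-+-* p i o)) (ℕ∣.m∣m*n (p ℕ.^ o))

  IsValℕ-unique : ∀ {N} i j → IsValℕ p N i → IsValℕ p N j → i ≡ j
  IsValℕ-unique i j (pⁱ∣N , pⁱ⁺¹∤N) (pʲ∣N , pʲ⁺¹∤N) with ℕₚ.<-cmp i j
  ... | tri≈ _ i≡j _ = i≡j
  ... | tri< i<j _ _ = contradiction (ℕ∣.∣-trans (^-monoʳ-∣ i<j) pʲ∣N) pⁱ⁺¹∤N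
  ... | tri> _ _ j<i = contradiction (ℕ∣.∣-trans (^-monoʳ-∣ j<i) pⁱ∣N) pʲ⁺¹∤N

  -- After cancelling `p ^ (i + j)`, one more factor `p` would divide the product of the cofactors,
  -- hence one of them by Euclid's lemma.
  IsValℕ-* : ∀ {A B} i j → IsValℕ p A i → IsValℕ p B j → IsValℕ p (A ℕ.* B) (i ℕ.+ j)
  -- From here on `A` and `B` denote the cofactors of `p ^ i` and `p ^ j`.
  IsValℕ-* i j (ℕ∣.divides-refl A , ∤A) (ℕ∣.divides-refl B , ∤B) =
    ℕ∣.divides (A ℕ.* B) ABpⁱ⁺ʲ , ∤AB
    where
    instance
      pⁱ⁺ʲ≢0 = ℕₚ.m^n≢0 p (i ℕ.+ j)
    regroup : ∀ A B x y → A ℕ.* x ℕ.* (B ℕ.* y) ≡ A ℕ.* B ℕ.* (x ℕ.* y)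
    regroup = ℕ-Solver.solve-∀
    ABpⁱ⁺ʲ : A ℕ.* p ℕ.^ i ℕ.* (B ℕ.* p ℕ.^ j) ≡ A ℕ.* B ℕ.* p ℕ.^ (i ℕ.+ j)
    ABpⁱ⁺ʲ = trans (regroup A B (p ℕ.^ i) (p ℕ.^ j))
                   (cong (A ℕ.* B ℕ.*_) (sym (ℕₚ.^-distribˡ-+-* p i j)))
    ∤AB : ℕ∣._∤_ (p ℕ.^ suc (i ℕ.+ j)) (A ℕ.* p ℕ.^ i ℕ.* (B ℕ.* p ℕ.^ j))
    ∤AB d with euclidsLemma A B prime
      (ℕ∣.*-cancelʳ-∣ (p ℕ.^ (i ℕ.+ j)) (subst (p ℕ.^ suc (i ℕ.+ j) ℕ∣.∣_) ABpⁱ⁺ʲ d))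
    ... | inj₁ p∣A = ∤A (ℕ∣.*-monoˡ-∣ (p ℕ.^ i) p∣A)
    ... | inj₂ p∣B = ∤B (ℕ∣.*-monoˡ-∣ (p ℕ.^ j) p∣B)

  -- The value at 0 is arbitrary; it makes `ν` total, as a colouring of all naturals has to be.
  ν : ℕ → ℕ
  ν zero      = 0
  ν N@(suc _) = proj₁ (IsValℕ-exists N)

  ν-isVal : ∀ N → .{{NonZero N}} → IsValℕ p N (ν N)
  ν-isVal N@(suc _) = proj₂ (IsValℕ-exists N)

  ν-* : ∀ A B → .{{NonZero A}} → .{{NonZero B}} → ν (A ℕ.* B) ≡ ν A ℕ.+ ν B
  ν-* A B = IsValℕ-unique (ν (A ℕ.* B)) (ν A ℕ.+ ν B) (ν-isVal (A ℕ.* B) {{ℕₚ.m*n≢0 A B}})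
                               (IsValℕ-* (ν A) (ν B) (ν-isVal A) (ν-isVal B))

  ν-1 : ν 1 ≡ 0
  ν-1 = ℕₚ.+-cancelˡ-≡ (ν 1) (ν 1) 0 (trans (sym (ν-* 1 1)) (sym (ℕₚ.+-identityʳ (ν 1))))

  νℚ : ℚ → ℤ
  νℚ q = + ν ∣ ↥ q ∣ ℤ.- + ν (↧ₙ q)

  numerator≢0 : ∀ {q} → q ≢ 0ℚ → NonZero ∣ ↥ q ∣
  numerator≢0 {q} q≢0 = ℕ.≢-nonZero (q≢0 ∘ ℚₚ.↥p≡0⇒p≡0 q ∘ ℤₚ.∣i∣≡0⇒i≡0)

  IsVal⇒νℚ : ∀ {q v} → q ≢ 0ℚ → IsVal p q v → v ≡ νℚ q
  IsVal⇒νℚ {q} q≢0 (i , j , vi , vj , refl) = cong₂ (λ i j → + i ℤ.- + j)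
    (IsValℕ-unique i (ν ∣ ↥ q ∣) vi (ν-isVal ∣ ↥ q ∣ {{numerator≢0 q≢0}})) (IsValℕ-unique j (ν (↧ₙ q)) vj (ν-isVal (↧ₙ q)))

  -- Any fraction equal to `q` up to sign gives the valuation, by additivity of `ν` on the
  -- cross-multiplied equation. Products thus need not be reduced to lowest terms.
  νℚ-fraction : ∀ {q} A B → .{{NonZero A}} → .{{NonZero B}} → q ≢ 0ℚ →
                ∣ ↥ q ∣ ℕ.* B ≡ A ℕ.* ↧ₙ q → νℚ q ≡ + ν A ℤ.- + ν B
  νℚ-fraction {q} A B q≢0 eq = begin
    + ν n ℤ.- + ν d                        ≡⟨ expand (+ ν n) (+ ν d) (+ ν B) ⟩
    (+ ν n ℤ.+ + ν B) ℤ.- (+ ν B ℤ.+ + ν d) ≡⟨ cong (λ s → + s ℤ.- (+ ν B ℤ.+ + ν d)) sums ⟩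
    (+ ν A ℤ.+ + ν d) ℤ.- (+ ν B ℤ.+ + ν d) ≡⟨ collapse (+ ν A) (+ ν d) (+ ν B) ⟩
    + ν A ℤ.- + ν B                        ∎
    where
    n = ∣ ↥ q ∣
    d = ↧ₙ q
    instance n≢0 = numerator≢0 q≢0
    sums : ν n ℕ.+ ν B ≡ ν A ℕ.+ ν d
    sums = trans (sym (ν-* n B)) (trans (cong ν eq) (ν-* A d))
    expand : ∀ n d b → n ℤ.- d ≡ (n ℤ.+ b) ℤ.- (b ℤ.+ d)
    expand = ℤ-Solver.solve-∀
    collapse : ∀ a d b → (a ℤ.+ d) ℤ.- (b ℤ.+ d) ≡ a ℤ.- b
    collapse = ℤ-Solver.solve-∀

  νℚ-ℕ→ℚ : ∀ x → .{{NonZero x}} → νℚ (ℕ→ℚ x) ≡ + ν x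
  νℚ-ℕ→ℚ x = begin
    νℚ (ℕ→ℚ x)       ≡⟨ νℚ-fraction x 1 (ℕ→ℚ-≢0 x) fraction ⟩
    + ν x ℤ.- + ν 1  ≡⟨ cong (λ i → + ν x ℤ.- + i) ν-1 ⟩
    + ν x ℤ.- +0     ≡⟨ ℤₚ.+-identityʳ (+ ν x) ⟩
    + ν x            ∎
    where
    fraction : ∣ ↥ ℕ→ℚ x ∣ ℕ.* 1 ≡ x ℕ.* ↧ₙ ℕ→ℚ x
    fraction = ≃ᵘ⇒cross-≡ (ℕ→ℚ x) (mkℚᵘ (+ x) 0) (ℚₚ.toℚᵘ-fromℚᵘ (mkℚᵘ (+ x) 0))

  νℚ-* : ∀ {q r} → q ≢ 0ℚ → r ≢ 0ℚ → νℚ (q * r) ≡ νℚ q ℤ.+ νℚ r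
  νℚ-* {q@record{}} {r@record{}} q≢0 r≢0 = begin
    νℚ (q * r)
      ≡⟨ νℚ-fraction (nq ℕ.* nr) (dq ℕ.* dr) {{ℕₚ.m*n≢0 nq nr}} (*-≢0 q≢0 r≢0) fraction ⟩
    + ν (nq ℕ.* nr) ℤ.- + ν (dq ℕ.* dr)
      ≡⟨ cong₂ (λ i j → + i ℤ.- + j) (ν-* nq nr) (ν-* dq dr) ⟩
    (+ ν nq ℤ.+ + ν nr) ℤ.- (+ ν dq ℤ.+ + ν dr)
      ≡⟨ regroup (+ ν nq) (+ ν nr) (+ ν dq) (+ ν dr) ⟩
    νℚ q ℤ.+ νℚ r ∎
    where
    nq = ∣ ↥ q ∣
    nr = ∣ ↥ r ∣
    dq = ↧ₙ q
    dr = ↧ₙ r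
    instance
      nq≢0 = numerator≢0 q≢0
      nr≢0 = numerator≢0 r≢0
    regroup : ∀ a b c d → (a ℤ.+ b) ℤ.- (c ℤ.+ d) ≡ (a ℤ.- c) ℤ.+ (b ℤ.- d)
    regroup = ℤ-Solver.solve-∀
    fraction : ∣ ↥ (q * r) ∣ ℕ.* (dq ℕ.* dr) ≡ nq ℕ.* nr ℕ.* ↧ₙ (q * r)
    fraction = trans (≃ᵘ⇒cross-≡ (q * r) (toℚᵘ q ℚᵘ.* toℚᵘ r) (ℚₚ.toℚᵘ-homo-* q r))
                     (cong (ℕ._* ↧ₙ (q * r)) (ℤₚ.abs-* (↥ q) (↥ r)))

  νℚ-1 : νℚ 1ℚ ≡ +0
  νℚ-1 = ℤₚ.+-inverseʳ (+ ν 1)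

  νℚ-inv : ∀ {q} → q ≢ 0ℚ → νℚ (inv q) ≡ ℤ.- νℚ q
  νℚ-inv {q} q≢0 = begin
    νℚ (inv q)                              ≡⟨ expand (νℚ q) (νℚ (inv q)) ⟩
    ℤ.- νℚ q ℤ.+ (νℚ q ℤ.+ νℚ (inv q))      ≡⟨ cong (ℤ._+_ (ℤ.- νℚ q)) (νℚ-* q≢0 (inv-≢0 q≢0)) ⟨
    ℤ.- νℚ q ℤ.+ νℚ (q * inv q)             ≡⟨ cong (λ r → ℤ.- νℚ q ℤ.+ νℚ r) (*-invʳ q q≢0) ⟩
    ℤ.- νℚ q ℤ.+ νℚ 1ℚ                      ≡⟨ cong (ℤ._+_ (ℤ.- νℚ q)) νℚ-1 ⟩
    ℤ.- νℚ q ℤ.+ +0                         ≡⟨ ℤₚ.+-identityʳ _ ⟩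
    ℤ.- νℚ q                                ∎
    where
    expand : ∀ u v → v ≡ ℤ.- u ℤ.+ (u ℤ.+ v)
    expand = ℤ-Solver.solve-∀

  νℚ-^ℕ : ∀ {q} k → q ≢ 0ℚ → νℚ (q ^ℕ k) ≡ + k ℤ.* νℚ q
  νℚ-^ℕ {q} zero    q≢0 = trans νℚ-1 (sym (ℤₚ.*-zeroˡ (νℚ q)))
  νℚ-^ℕ {q} (suc k) q≢0 = begin
    νℚ (q * (q ^ℕ k))         ≡⟨ νℚ-* q≢0 (^ℕ-≢0 k q≢0) ⟩
    νℚ q ℤ.+ νℚ (q ^ℕ k)      ≡⟨ cong (ℤ._+_ (νℚ q)) (νℚ-^ℕ k q≢0) ⟩
    νℚ q ℤ.+ + k ℤ.* νℚ q     ≡⟨ ℤₚ.suc-* (+ k) (νℚ q) ⟨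
    + suc k ℤ.* νℚ q          ∎

  νℚ-^ℤ : ∀ {q} i → q ≢ 0ℚ → νℚ (q ^ℤ i) ≡ i ℤ.* νℚ q
  νℚ-^ℤ     (+ k)    q≢0 = νℚ-^ℕ k q≢0
  νℚ-^ℤ {q} -[1+ k ] q≢0 = begin
    νℚ (inv (q ^ℕ suc k))      ≡⟨ νℚ-inv (^ℕ-≢0 (suc k) q≢0) ⟩
    ℤ.- νℚ (q ^ℕ suc k)        ≡⟨ cong ℤ.-_ (νℚ-^ℕ (suc k) q≢0) ⟩
    ℤ.- (+ suc k ℤ.* νℚ q)     ≡⟨ ℤₚ.neg-distribˡ-* (+ suc k) (νℚ q) ⟩
    -[1+ k ] ℤ.* νℚ q          ∎

-- Partition regularity

ratio-* : ∀ a {b} → b ≢ 0ℤ → ℤ→ℚ a ≡ ratio a b * ℤ→ℚ b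
ratio-* a {b} b≢0 = sym (inv-cancel-* (ℤ→ℚ a) (ℤ→ℚ b) (ℤ→ℚ-≢0 b b≢0))

mod-≡⇒∣- : ∀ M .{{_ : NonZero M}} x y → x mod M ≡ y mod M → (+ M) ℤ∣ₛ.∣ (+ y ℤ.- + x)
mod-≡⇒∣- M x y eq = ℤ∣ₛ.divides (+ (y / M) ℤ.- + (x / M)) (begin
  + y ℤ.- + x
    ≡⟨ cong₂ (λ i j → i ℤ.- j) (division y) (division x) ⟩
  (+ (y % M) ℤ.+ + (y / M) ℤ.* + M) ℤ.- (+ (x % M) ℤ.+ + (x / M) ℤ.* + M)
    ≡⟨ cong (λ r → (+ r ℤ.+ + (y / M) ℤ.* + M) ℤ.- (+ (x % M) ℤ.+ + (x / M) ℤ.* + M)) remainders ⟩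
  (+ (x % M) ℤ.+ + (y / M) ℤ.* + M) ℤ.- (+ (x % M) ℤ.+ + (x / M) ℤ.* + M)
    ≡⟨ arith (+ (x % M)) (+ (y / M)) (+ (x / M)) (+ M) ⟩
  (+ (y / M) ℤ.- + (x / M)) ℤ.* + M ∎)
  where
  division : ∀ z → + z ≡ + (z % M) ℤ.+ + (z / M) ℤ.* + M
  division z = trans (cong +_ (m≡m%n+[m/n]*n z M)) (cong (ℤ._+_ (+ (z % M))) (ℤₚ.pos-* (z / M) M))
  remainders : y % M ≡ x % M
  remainders = sym (Finₚ.fromℕ<-injective _ _ (m%n<n x M) (m%n<n y M) eq)
  arith : ∀ r s t m → (r ℤ.+ s ℤ.* m) ℤ.- (r ℤ.+ t ℤ.* m) ≡ (s ℤ.- t) ℤ.* m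
  arith = ℤ-Solver.solve-∀

suc∣i∣∣i⇒i≡0 : ∀ i → suc ∣ i ∣ ℕ∣.∣ ∣ i ∣ → i ≡ 0ℤ
suc∣i∣∣i⇒i≡0 +0         _   = refl
suc∣i∣∣i⇒i≡0 i@(+[1+ _ ]) div = contradiction div (ℕ∣.>⇒∤ (ℕₚ.n<1+n ∣ i ∣))
suc∣i∣∣i⇒i≡0 i@(-[1+ _ ]) div = contradiction div (ℕ∣.>⇒∤ (ℕₚ.n<1+n ∣ i ∣))

-- Both `n * d` and `m * z` are multiples of `m`. The absolute value appears because the modulus of
-- a colouring is a natural number.
∣m∣∣d⇒m∣n*v : ∀ m n v → ∃ (λ d → ∃ λ z → (+ ∣ m ∣) ℤ∣ₛ.∣ d × n ℤ.* v ≡ n ℤ.* d ℤ.- m ℤ.* z) →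
  m ℤ∣.∣ (n ℤ.* v)
∣m∣∣d⇒m∣n*v m n v (d , z , ∣m∣∣d , eq) = ℤ∣ₛ.∣⇒∣ᵤ (subst (m ℤ∣ₛ.∣_) (sym eq)
  (ℤ∣ₛ.∣m∣n⇒∣m-n (ℤ∣ₛ.∣n⇒∣m*n n (ℤ∣ₛ.∣-trans ℤ∣ₛ.m∣∣m∣ ∣m∣∣d)) (ℤ∣ₛ.∣m⇒∣m*n z ℤ∣ₛ.∣-refl)))

-- For m ≠ 0 take M = |m|; for m = 0 the modulus M = |v| + 1 forces v = 0.
m∣n*v : ∀ m n → n ≢ 0ℤ → ∀ v →
  (∀ M → .{{NonZero M}} → ∃ λ d → ∃ λ z → (+ M) ℤ∣ₛ.∣ d × n ℤ.* v ≡ n ℤ.* d ℤ.- m ℤ.* z) →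
  m ℤ∣.∣ (n ℤ.* v)
m∣n*v +0 n n≢0 v solution with solution (suc ∣ v ∣)
... | d , z , M∣d , eq = ℤ∣ₛ.∣⇒∣ᵤ (subst (0ℤ ℤ∣ₛ.∣_) (sym nv≡0) ℤ∣ₛ.∣-refl)
  where
  instance n-nonZero = ℤ.≢-nonZero n≢0
  v≡d : v ≡ d
  v≡d = ℤₚ.*-cancelˡ-≡ n v d (trans eq (ℤₚ.+-identityʳ (n ℤ.* d)))
  v≡0 : v ≡ 0ℤ
  v≡0 = suc∣i∣∣i⇒i≡0 v (subst (λ i → suc ∣ v ∣ ℕ∣.∣ ∣ i ∣) (sym v≡d) (ℤ∣ₛ.∣⇒∣ᵤ M∣d))
  nv≡0 : n ℤ.* v ≡ 0ℤ
  nv≡0 = trans (cong (n ℤ.*_) v≡0) (ℤₚ.*-zeroʳ n)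
m∣n*v m@(+[1+ _ ]) n n≢0 v solution = ∣m∣∣d⇒m∣n*v m n v (solution ∣ m ∣)
m∣n*v m@(-[1+ _ ]) n n≢0 v solution = ∣m∣∣d⇒m∣n*v m n v (solution ∣ m ∣)

module Necessity (m n a b : ℤ) (n≢0 : n ≢ 0ℤ) (b≢0 : b ≢ 0ℤ) (regular : PartitionRegular m n a b) where

  b^n≢0 : ℤ→ℚ b ^ℤ n ≢ 0ℚ
  b^n≢0 = ^ℤ-≢0 n (ℤ→ℚ-≢0 b b≢0)

  a≢0 : a ≢ 0ℤ
  -- One colour is enough: any solution with `a = 0` equates 0 with a nonzero right-hand side.
  a≢0 refl with regular 1 (λ _ → zero)
  ... | x , y , z , x≢0 , y≢0 , z≢0 , _ , _ , eqn =
    *-≢0 b^n≢0 (^ℤ-≢0 n (ℕ→ℚ-≢0 y {{y≢0}})) (begin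
      (ℤ→ℚ b ^ℤ n) * (ℕ→ℚ y ^ℤ n)              ≡⟨ eqn ⟨
      (0ℚ ^ℤ n) * (ℕ→ℚ x ^ℤ n) * (ℕ→ℚ z ^ℤ m)  ≡⟨ cong (λ q → q * (ℕ→ℚ x ^ℤ n) * (ℕ→ℚ z ^ℤ m)) (0^ℤ n n≢0) ⟩
      0ℚ * (ℕ→ℚ x ^ℤ n) * (ℕ→ℚ z ^ℤ m)         ≡⟨ cong (_* (ℕ→ℚ z ^ℤ m)) (ℚₚ.*-zeroˡ (ℕ→ℚ x ^ℤ n)) ⟩
      0ℚ * (ℕ→ℚ z ^ℤ m)                        ≡⟨ ℚₚ.*-zeroˡ (ℕ→ℚ z ^ℤ m) ⟩
      0ℚ                                       ∎)

  ratio≢0 : ratio a b ≢ 0ℚ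
  ratio≢0 = *-≢0 (ℤ→ℚ-≢0 a a≢0) (inv-≢0 (ℤ→ℚ-≢0 b b≢0))

  module _ {p : ℕ} (prime : Prime p) where
    open Valuation prime

    valuation-equation : ∀ {x y z} → .{{NonZero x}} → .{{NonZero y}} → .{{NonZero z}} → Eqn m n a b x y z →
      n ℤ.* νℚ (ratio a b) ≡ n ℤ.* (+ ν y ℤ.- + ν x) ℤ.- m ℤ.* + ν z
    valuation-equation {x} {y} {z} eqn = begin
      n ℤ.* v
        ≡⟨ expand n v β X (m ℤ.* Z) ⟩
      (n ℤ.* (v ℤ.+ β) ℤ.+ n ℤ.* X ℤ.+ m ℤ.* Z) ℤ.- (n ℤ.* β ℤ.+ n ℤ.* X ℤ.+ m ℤ.* Z)
        ≡⟨ cong (ℤ._- (n ℤ.* β ℤ.+ n ℤ.* X ℤ.+ m ℤ.* Z)) both ⟩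
      (n ℤ.* β ℤ.+ n ℤ.* Y) ℤ.- (n ℤ.* β ℤ.+ n ℤ.* X ℤ.+ m ℤ.* Z)
        ≡⟨ collapse n β X Y (m ℤ.* Z) ⟩
      n ℤ.* (Y ℤ.- X) ℤ.- m ℤ.* Z ∎
      where
      v = νℚ (ratio a b)
      β = νℚ (ℤ→ℚ b)
      X = + ν x
      Y = + ν y
      Z = + ν z
      a^n≢0 = ^ℤ-≢0 n (ℤ→ℚ-≢0 a a≢0)
      x^n≢0 = ^ℤ-≢0 n (ℕ→ℚ-≢0 x)
      y^n≢0 = ^ℤ-≢0 n (ℕ→ℚ-≢0 y)
      z^m≢0 = ^ℤ-≢0 m (ℕ→ℚ-≢0 z)
      -- Writing `a` as `ratio a b` times `b` lets the valuation `β` of `b` cancel between the two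
      -- sides.
      νa : νℚ (ℤ→ℚ a) ≡ v ℤ.+ β
      νa = trans (cong νℚ (ratio-* a b≢0)) (νℚ-* ratio≢0 (ℤ→ℚ-≢0 b b≢0))
      power : ∀ w → .{{NonZero w}} → ∀ i → νℚ (ℕ→ℚ w ^ℤ i) ≡ i ℤ.* + ν w
      power w i = trans (νℚ-^ℤ i (ℕ→ℚ-≢0 w)) (cong (i ℤ.*_) (νℚ-ℕ→ℚ w))
      both : n ℤ.* (v ℤ.+ β) ℤ.+ n ℤ.* X ℤ.+ m ℤ.* Z ≡ n ℤ.* β ℤ.+ n ℤ.* Y
      both = begin
        n ℤ.* (v ℤ.+ β) ℤ.+ n ℤ.* X ℤ.+ m ℤ.* Z
          ≡⟨ cong₂ ℤ._+_ (cong₂ ℤ._+_ (trans (νℚ-^ℤ n (ℤ→ℚ-≢0 a a≢0)) (cong (n ℤ.*_) νa)) (power x n)) (power z m) ⟨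
        νℚ (ℤ→ℚ a ^ℤ n) ℤ.+ νℚ (ℕ→ℚ x ^ℤ n) ℤ.+ νℚ (ℕ→ℚ z ^ℤ m)
          ≡⟨ cong (ℤ._+ νℚ (ℕ→ℚ z ^ℤ m)) (νℚ-* a^n≢0 x^n≢0) ⟨
        νℚ ((ℤ→ℚ a ^ℤ n) * (ℕ→ℚ x ^ℤ n)) ℤ.+ νℚ (ℕ→ℚ z ^ℤ m)
          ≡⟨ νℚ-* (*-≢0 a^n≢0 x^n≢0) z^m≢0 ⟨
        νℚ ((ℤ→ℚ a ^ℤ n) * (ℕ→ℚ x ^ℤ n) * (ℕ→ℚ z ^ℤ m))
          ≡⟨ cong νℚ eqn ⟩
        νℚ ((ℤ→ℚ b ^ℤ n) * (ℕ→ℚ y ^ℤ n))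
          ≡⟨ νℚ-* b^n≢0 y^n≢0 ⟩
        νℚ (ℤ→ℚ b ^ℤ n) ℤ.+ νℚ (ℕ→ℚ y ^ℤ n)
          ≡⟨ cong₂ ℤ._+_ (νℚ-^ℤ n (ℤ→ℚ-≢0 b b≢0)) (power y n) ⟩
        n ℤ.* β ℤ.+ n ℤ.* Y ∎
      expand : ∀ n v β X u → n ℤ.* v ≡
        (n ℤ.* (v ℤ.+ β) ℤ.+ n ℤ.* X ℤ.+ u) ℤ.- (n ℤ.* β ℤ.+ n ℤ.* X ℤ.+ u)
      expand = ℤ-Solver.solve-∀
      collapse : ∀ n β X Y u →
        (n ℤ.* β ℤ.+ n ℤ.* Y) ℤ.- (n ℤ.* β ℤ.+ n ℤ.* X ℤ.+ u) ≡ n ℤ.* (Y ℤ.- X) ℤ.- u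
      collapse = ℤ-Solver.solve-∀

    -- `M` is kept free because `m = 0` needs a modulus exceeding the absolute value of the
    -- valuation itself.
    monochromatic-solution : ∀ M → .{{_ : NonZero M}} → ∃ λ d → ∃ λ z →
      (+ M) ℤ∣ₛ.∣ d × n ℤ.* νℚ (ratio a b) ≡ n ℤ.* d ℤ.- m ℤ.* z
    monochromatic-solution M with regular M (λ w → ν w mod M)
    ... | x , y , z , x≢0 , y≢0 , z≢0 , cx≡cy , _ , eqn =
      + ν y ℤ.- + ν x , + ν z , mod-≡⇒∣- M (ν x) (ν y) cx≡cy ,
      valuation-equation {{x≢0}} {{y≢0}} {{z≢0}} eqn

    m∣nν : m ℤ∣.∣ (n ℤ.* νℚ (ratio a b))
    m∣nν = m∣n*v m n n≢0 (νℚ (ratio a b)) monochromatic-solution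

  isPowerℚ : IsPowerℚ m n (ratio a b)
  isPowerℚ = ratio≢0 , λ p prime v isVal →
    subst (λ v → m ℤ∣.∣ (n ℤ.* v)) (sym (Valuation.IsVal⇒νℚ prime ratio≢0 isVal)) (m∣nν prime)

-- Brauer's configuration in the exponents of l, shifted down by one so that l z is a perfect power.
geometric : ∀ l M N → .{{NonZero l}} → .{{NonZero N}} → ∀ {k} (c : Colouring k) →
  ∃ λ u → ∃ λ q → ∃ λ z → NonZero u × NonZero q × NonZero z ×
    l ℕ.* z ≡ q ℕ.^ N × c u ≡ c (u ℕ.* q ℕ.^ M) × c u ≡ c z
geometric l M N@(suc _) c with brauer M N (s≤s z≤n) (λ e → c (l ℕ.^ ℕ.pred e))
... | suc e , w@(suc _) , _ , _ , eq₁ , eq₂ =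
  l ℕ.^ e , l ℕ.^ w , l ℕ.^ ℕ.pred (N ℕ.* w) ,
  ℕₚ.m^n≢0 l e , ℕₚ.m^n≢0 l w , ℕₚ.m^n≢0 l (ℕ.pred (N ℕ.* w)) ,
  -- `N` and `w` are matched as successors, so `N * w` is one too and `l * l ^ pred (N * w)`
  -- computes to `l ^ (N * w)`.
  trans (cong (l ℕ.^_) (ℕₚ.*-comm N w)) (sym (ℕₚ.^-*-assoc l w N)) ,
  trans eq₁ (cong c (begin
    l ℕ.^ (e ℕ.+ M ℕ.* w)        ≡⟨ ℕₚ.^-distribˡ-+-* l e (M ℕ.* w) ⟩
    l ℕ.^ e ℕ.* l ℕ.^ (M ℕ.* w)  ≡⟨ cong (λ i → l ℕ.^ e ℕ.* l ℕ.^ i) (ℕₚ.*-comm M w) ⟩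
    l ℕ.^ e ℕ.* l ℕ.^ (w ℕ.* M)  ≡⟨ cong (l ℕ.^ e ℕ.*_) (ℕₚ.^-*-assoc l w M) ⟨
    l ℕ.^ e ℕ.* (l ℕ.^ w) ℕ.^ M  ∎)) ,
  eq₂

ℕ-^-distribʳ-* : ∀ x y k → (x ℕ.* y) ℕ.^ k ≡ x ℕ.^ k ℕ.* y ℕ.^ k
ℕ-^-distribʳ-* x y zero    = refl
ℕ-^-distribʳ-* x y (suc k) = trans (cong (x ℕ.* y ℕ.*_) (ℕ-^-distribʳ-* x y k)) (arith x y (x ℕ.^ k) (y ℕ.^ k))
  where
  arith : ∀ x y u v → x ℕ.* y ℕ.* (u ℕ.* v) ≡ x ℕ.* u ℕ.* (y ℕ.* v)
  arith = ℕ-Solver.solve-∀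

-- The exchange of exponents that makes the ratio `q ^ |m|` of `x` and `y` fit with `l z = q ^ |n|`.
shift-^ : ∀ u q M N → (u ℕ.* q ℕ.^ M) ℕ.^ N ≡ u ℕ.^ N ℕ.* (q ℕ.^ N) ℕ.^ M
shift-^ u q M N = begin
  (u ℕ.* q ℕ.^ M) ℕ.^ N            ≡⟨ ℕ-^-distribʳ-* u (q ℕ.^ M) N ⟩
  u ℕ.^ N ℕ.* (q ℕ.^ M) ℕ.^ N      ≡⟨ cong (u ℕ.^ N ℕ.*_) (ℕₚ.^-*-assoc q M N) ⟩
  u ℕ.^ N ℕ.* q ℕ.^ (M ℕ.* N)      ≡⟨ cong (λ i → u ℕ.^ N ℕ.* q ℕ.^ i) (ℕₚ.*-comm M N) ⟩
  u ℕ.^ N ℕ.* q ℕ.^ (N ℕ.* M)      ≡⟨ cong (u ℕ.^ N ℕ.*_) (ℕₚ.^-*-assoc q N M) ⟨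
  u ℕ.^ N ℕ.* (q ℕ.^ N) ℕ.^ M      ∎

shift-^ℕ : ∀ u q M N → ℕ→ℚ (u ℕ.* q ℕ.^ M) ^ℕ N ≡ (ℕ→ℚ u ^ℕ N) * (ℕ→ℚ (q ℕ.^ N) ^ℕ M)
shift-^ℕ u q M N = begin
  ℕ→ℚ (u ℕ.* q ℕ.^ M) ^ℕ N                      ≡⟨ ℕ→ℚ-^ (u ℕ.* q ℕ.^ M) N ⟩
  ℕ→ℚ ((u ℕ.* q ℕ.^ M) ℕ.^ N)                   ≡⟨ cong ℕ→ℚ (shift-^ u q M N) ⟩
  ℕ→ℚ (u ℕ.^ N ℕ.* (q ℕ.^ N) ℕ.^ M)             ≡⟨ ℕ→ℚ-* (u ℕ.^ N) ((q ℕ.^ N) ℕ.^ M) ⟩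
  ℕ→ℚ (u ℕ.^ N) * ℕ→ℚ ((q ℕ.^ N) ℕ.^ M)         ≡⟨ cong₂ _*_ (ℕ→ℚ-^ u N) (ℕ→ℚ-^ (q ℕ.^ N) M) ⟨
  (ℕ→ℚ u ^ℕ N) * (ℕ→ℚ (q ℕ.^ N) ^ℕ M)           ∎

-- What remains of the equation after dividing by `b^n` and absorbing `(a/b)^n = l^m`, with `t` for
-- `l z`.
PowerEqn : (m n : ℤ) (x y t : ℕ) → Set
PowerEqn m n x y t = (ℕ→ℚ x ^ℤ n) * (ℕ→ℚ t ^ℤ m) ≡ ℕ→ℚ y ^ℤ n

-- The larger of u and u q^|m| is y if m and n have the same sign, and x otherwise.
signed-solution : ∀ m n {k} (c : Colouring k) u q → .{{NonZero q}} → NonZero u →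
  c u ≡ c (u ℕ.* q ℕ.^ ∣ m ∣) →
  ∃ λ x → ∃ λ y → NonZero x × NonZero y × c u ≡ c x × c u ≡ c y × PowerEqn m n x y (q ℕ.^ ∣ n ∣)
signed-solution m n c u q u≢0 = go m n
  where
  uqᴹ≢0 : ∀ M → NonZero (u ℕ.* q ℕ.^ M)
  uqᴹ≢0 M = ℕₚ.m*n≢0 u (q ℕ.^ M) {{u≢0}} {{ℕₚ.m^n≢0 q M}}
  uᴺ≢0 : ∀ N → ℕ→ℚ u ^ℕ N ≢ 0ℚ
  uᴺ≢0 N = ^ℕ-≢0 N (ℕ→ℚ-≢0 u {{u≢0}})
  qᴺᴹ≢0 : ∀ N M → ℕ→ℚ (q ℕ.^ N) ^ℕ M ≢ 0ℚ
  qᴺᴹ≢0 N M = ^ℕ-≢0 M (ℕ→ℚ-≢0 (q ℕ.^ N) {{ℕₚ.m^n≢0 q N}})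
  go : ∀ m n → c u ≡ c (u ℕ.* q ℕ.^ ∣ m ∣) →
    ∃ λ x → ∃ λ y → NonZero x × NonZero y × c u ≡ c x × c u ≡ c y × PowerEqn m n x y (q ℕ.^ ∣ n ∣)
  go (+ M) (+ N) same =
    u , u ℕ.* q ℕ.^ M , u≢0 , uqᴹ≢0 M , refl , same , sym (shift-^ℕ u q M N)
  go -[1+ M ] (+ N) same =
    u ℕ.* q ℕ.^ suc M , u , uqᴹ≢0 (suc M) , u≢0 , same , refl ,
    trans (cong (_* inv (ℕ→ℚ (q ℕ.^ N) ^ℕ suc M)) (shift-^ℕ u q (suc M) N))
          (*-cancel-inv _ _ (qᴺᴹ≢0 N (suc M)))
  go (+ M) -[1+ N ] same =
    u ℕ.* q ℕ.^ M , u , uqᴹ≢0 M , u≢0 , same , refl ,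
    trans (cong (λ s → inv s * (ℕ→ℚ (q ℕ.^ suc N) ^ℕ M)) (shift-^ℕ u q M (suc N)))
      (trans (cong (_* (ℕ→ℚ (q ℕ.^ suc N) ^ℕ M)) (inv-distrib-* _ _ (uᴺ≢0 (suc N)) (qᴺᴹ≢0 (suc N) M)))
             (inv-cancel-* _ _ (qᴺᴹ≢0 (suc N) M)))
  go -[1+ M ] -[1+ N ] same =
    u , u ℕ.* q ℕ.^ suc M , u≢0 , uqᴹ≢0 (suc M) , refl , same ,
    sym (trans (cong inv (shift-^ℕ u q (suc M) (suc N)))
               (inv-distrib-* _ _ (uᴺ≢0 (suc N)) (qᴺᴹ≢0 (suc N) (suc M))))

-- The root l can be 0 only when m = 0, and then 1 is a root as well.
IsPowerℕ-root≢0 : ∀ m n r → IsPowerℕ m n r → ∃ λ l → NonZero l × r ^ℤ n ≡ ℕ→ℚ l ^ℤ m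
IsPowerℕ-root≢0 m n r (r>0 , l@(suc _) , eq) = l , _ , eq
IsPowerℕ-root≢0 m n r (r>0 , zero , eq) with m ℤₚ.≟ 0ℤ
... | yes refl = 1 , _ , eq
... | no m≢0   = contradiction (trans eq (0^ℤ m m≢0)) (^ℤ-≢0 n (ℚₚ.<⇒≢ r>0 ∘ sym))

-- Substitute `(a/b) b` for `a`, then `l^m` for `(a/b)^n`, and merge `l^m z^m` into `(l z)^m`; the
-- factor `b^n` is carried along in front.
PowerEqn⇒Eqn : ∀ m n a b l x y z → b ≢ 0ℤ → ratio a b ≢ 0ℚ → .{{NonZero l}} → .{{NonZero z}} →
  ratio a b ^ℤ n ≡ ℕ→ℚ l ^ℤ m → PowerEqn m n x y (l ℕ.* z) → Eqn m n a b x y z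
PowerEqn⇒Eqn m n a b l x y z b≢0 r≢0 root eqn = begin
  (ℤ→ℚ a ^ℤ n) * X * Z                     ≡⟨ cong (λ q → (q ^ℤ n) * X * Z) (ratio-* a b≢0) ⟩
  ((ratio a b * ℤ→ℚ b) ^ℤ n) * X * Z       ≡⟨ cong (λ q → q * X * Z) (^ℤ-distrib-* n r≢0 (ℤ→ℚ-≢0 b b≢0)) ⟩
  (ratio a b ^ℤ n) * B * X * Z             ≡⟨ cong (λ q → q * B * X * Z) root ⟩
  L * B * X * Z                            ≡⟨ cong (λ q → q * X * Z) (ℚₚ.*-comm L B) ⟩
  B * L * X * Z                            ≡⟨ cong (_* Z) (ℚₚ.*-assoc B L X) ⟩
  B * (L * X) * Z                          ≡⟨ cong (λ q → B * q * Z) (ℚₚ.*-comm L X) ⟩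
  B * (X * L) * Z                          ≡⟨ ℚₚ.*-assoc B (X * L) Z ⟩
  B * (X * L * Z)                          ≡⟨ cong (B *_) (ℚₚ.*-assoc X L Z) ⟩
  B * (X * (L * Z))                        ≡⟨ cong (λ q → B * (X * q)) (^ℤ-distrib-* m (ℕ→ℚ-≢0 l) (ℕ→ℚ-≢0 z)) ⟨
  B * (X * ((ℕ→ℚ l * ℕ→ℚ z) ^ℤ m))         ≡⟨ cong (λ q → B * (X * (q ^ℤ m))) (ℕ→ℚ-* l z) ⟨
  B * (X * (ℕ→ℚ (l ℕ.* z) ^ℤ m))           ≡⟨ cong (B *_) eqn ⟩
  B * (ℕ→ℚ y ^ℤ n)                         ∎
  where
  B = ℤ→ℚ b ^ℤ n
  L = ℕ→ℚ l ^ℤ m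
  X = ℕ→ℚ x ^ℤ n
  Z = ℕ→ℚ z ^ℤ m

isPowerℕ⇒regular : ∀ m n a b → n ≢ 0ℤ → b ≢ 0ℤ → IsPowerℕ m n (ratio a b) → PartitionRegular m n a b
isPowerℕ⇒regular m n a b n≢0 b≢0 power@(r>0 , _) k c
  with IsPowerℕ-root≢0 m n (ratio a b) power
... | l , l≢0 , root
  with geometric l ∣ m ∣ ∣ n ∣ {{l≢0}} {{ℕ.≢-nonZero (n≢0 ∘ ℤₚ.∣i∣≡0⇒i≡0)}} c
... | u , q , z , u≢0 , q≢0 , z≢0 , lz≡qⁿ , cu≡ , cu≡cz
  with signed-solution m n c u q {{q≢0}} u≢0 cu≡
... | x , y , x≢0 , y≢0 , cu≡cx , cu≡cy , eqn =
  x , y , z , x≢0 , y≢0 , z≢0 , trans (sym cu≡cx) cu≡cy , trans (sym cu≡cy) cu≡cz ,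
  PowerEqn⇒Eqn m n a b l x y z b≢0 (ℚₚ.<⇒≢ r>0 ∘ sym) {{l≢0}} {{z≢0}} root
    (subst (PowerEqn m n x y) (sym lz≡qⁿ) eqn)

theorem4p9 : (m n a b : ℤ) → n ≢ 0ℤ → b ≢ 0ℤ → gcd m n ≡ 1ℤ → gcd a b ≡ 1ℤ →
    (PartitionRegular m n a b → IsPowerℚ m n (ratio a b)) ×
    (IsPowerℕ m n (ratio a b) → PartitionRegular m n a b)
theorem4p9 m n a b n≢0 b≢0 _ _ = Necessity.isPowerℚ m n a b n≢0 b≢0 , isPowerℕ⇒regular m n a b n≢0 b≢0
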